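{- Consider $m$ insertions into $4$ bins using any sequential 2-choice insertion strategy. With probability at least $1/\operatorname{poly}(m)$, some bin contains at least $m/4 + \Omega(\log m)$ balls. More generally, for $n$ bins, with probability at least $1/\operatorname{poly}(m)$, some bin contains at least $m/n + \Omega(\log_n m)$ balls.
   Context: Sequential 2-choice insertion strategy: balls are inserted one after another into initially empty bins; for each ball $x$ a uniformly random pair $(h_1(x),h_2(x))\in[n]\times[n]$ of distinct bins is drawn, independently across balls, and the strategy (possibly randomized, depending on the history so far) must place $x$ in bin $h_1(x)$ or $h_2(x)$ before the next ball's pair is revealed. The bin contents referred to are those after all $m$ insertions.
   Formalization: The general claim is stated for n ≥ 3 bins and m ≥ 1: for n = 2 it is false (every pair is both bins, so alternating gives exactly m/2 balls each for even m), for n = 1 there is no pair of distinct bins, and log m is undefined at m = 0. -}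

module Defs where

open import Algebra.Bundles using (CommutativeRing)
open import Data.Bool.Base using (if_then_else_)
open import Data.Fin.Base using (Fin)
import Data.Fin.Properties as Fin
open import Data.Integer.Base as ℤ using (+_)
import Data.Integer.Properties as ℤ
open import Data.List.Base using (List; []; _∷_; length; filter; map; foldr; allFin; cartesianProduct)
open import Data.Nat.Base as ℕ using (ℕ; zero; suc; NonZero)
import Data.Nat.Properties as ℕ
open import Data.Product.Base using (_×_; _,_; proj₂; ∃)
open import Data.Rational.Base as ℚ using (ℚ; 0ℚ; 1ℚ)
import Data.Rational.Properties as ℚ
import Data.Rational.Unnormalised.Base as ℚᵘ
import Data.Rational.Unnormalised.Properties as ℚᵘ
open import Level using (_⊔_; 0ℓ) renaming (suc to lsuc)
open import Relation.Binary.Core using (Rel)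
open import Relation.Binary.Structures using (IsPartialOrder)
open import Relation.Binary.PropositionalEquality using (_≡_; refl; sym; trans; cong; cong₂; subst; module ≡-Reasoning)
open import Relation.Nullary.Decidable using (Dec; does; ¬?)
open import Relation.Unary using (Pred; Decidable)

import Algebra.Definitions.RawMonoid as RawMonoidDefs

-- The library has no real numbers.  Probabilities live in an arbitrary
-- partially ordered commutative ring in which every positive integer has a
-- nonnegative inverse; ℝ (classical or constructive) and ℚ are examples.  The
-- order need not be total, since that of the constructive reals is not.
record Scalars c ℓ₁ ℓ₂ : Set (lsuc (c ⊔ ℓ₁ ⊔ ℓ₂)) where
  field
    commutativeRing : CommutativeRing c ℓ₁

  open CommutativeRing commutativeRing public
  open RawMonoidDefs +-rawMonoid public using () renaming (_×_ to _·_)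

  infix 4 _≤_
  field
    _≤_            : Rel Carrier ℓ₂
    isPartialOrder : IsPartialOrder _≈_ _≤_
    +-mono-≤       : ∀ {x y u v} → x ≤ y → u ≤ v → x + u ≤ y + v
    *-nonNeg       : ∀ {x y} → 0# ≤ x → 0# ≤ y → 0# ≤ x * y
    1/_            : (k : ℕ) .{{_ : NonZero k}} → Carrier
    1/-inverse     : (k : ℕ) .{{_ : NonZero k}} → k · (1/ k) ≈ 1#
    1/-nonNeg      : (k : ℕ) .{{_ : NonZero k}} → 0# ≤ 1/ k

Pair : ℕ → Set
Pair n = Fin n × Fin n

distinctPairs : (n : ℕ) → List (Pair n)
distinctPairs n = filter (λ (i , j) → ¬? (i Fin.≟ j)) (cartesianProduct (allFin n) (allFin n))

-- Most recent insertion first; each entry is the pair that was drawn and the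
-- bin in which the ball was placed.
History : ℕ → Set
History n = List (Pair n × Fin n)

load : ∀ {n} → History n → Fin n → ℕ
load h i = length (filter (λ s → proj₂ s Fin.≟ i) h)

-- ℓ ≥ m/n + (1/K)·log_b m, without real numbers.  Multiplying by K·n gives
-- n·log_b m + K·m ≤ K·n·ℓ; now apply b^(_).  (For b ≥ 2, and n, K, m ≥ 1.)
AtLeastMeanPlusLog : (K b n m ℓ : ℕ) → Set
AtLeastMeanPlusLog K b n m ℓ = m ℕ.^ n ℕ.* b ℕ.^ (K ℕ.* m) ℕ.≤ b ℕ.^ (K ℕ.* n ℕ.* ℓ)

SomeBinOverloaded : (K b n m : ℕ) → Pred (History n) 0ℓ
SomeBinOverloaded K b n m h = ∃ λ (i : Fin n) → AtLeastMeanPlusLog K b n m (load h i)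

someBinOverloaded? : (K b n m : ℕ) → Decidable (SomeBinOverloaded K b n m)
someBinOverloaded? K b n m h = Fin.any? (λ i → _ ℕ.≤? _)

module TwoChoice {c ℓ₁ ℓ₂} (R : Scalars c ℓ₁ ℓ₂) where
  open Scalars R

  -- Randomized and adaptive: given the history and the pair (h₁ , h₂) drawn for
  -- the next ball, `probFirst` is the conditional probability that the ball is
  -- placed in h₁; otherwise it is placed in h₂.
  record Strategy (n : ℕ) : Set (c ⊔ ℓ₂) where
    field
      probFirst   : History n → Pair n → Carrier
      0≤probFirst : ∀ h p → 0# ≤ probFirst h p
      probFirst≤1 : ∀ h p → probFirst h p ≤ 1#

  average : ∀ {a} {A : Set a} → List A → (A → Carrier) → Carrier
  average []          f = 0#
  average xs@(_ ∷ _)  f = 1/ length xs * foldr _+_ 0# (map f xs)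

  module _ {n : ℕ} (σ : Strategy n) {e} {E : Pred (History n) e} (E? : Decidable E) where
    open Strategy σ

    -- The probability that E holds after r further insertions, given that the
    -- history so far is h.
    probFrom : (r : ℕ) (h : History n) → Carrier
    probFrom zero    h = if does (E? h) then 1# else 0#
    probFrom (suc r) h = average (distinctPairs n) λ (i , j) →
      probFirst h (i , j) * probFrom r (((i , j) , i) ∷ h)
        + (1# - probFirst h (i , j)) * probFrom r (((i , j) , j) ∷ h)

    Pr : (m : ℕ) → Carrier
    Pr m = probFrom m []

  -- p ≥ 1/(C·m^d), with the denominator cleared.
  AtLeastInversePoly : (C d m : ℕ) → Carrier → Set ℓ₂
  AtLeastInversePoly C d m p = 1# ≤ (C ℕ.* m ℕ.^ d) · p

ℚ-scalars : Scalars 0ℓ 0ℓ 0ℓ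
ℚ-scalars = record
  { commutativeRing = ℚ.+-*-commutativeRing
  ; _≤_             = ℚ._≤_
  ; isPartialOrder  = ℚ.≤-isPartialOrder
  ; +-mono-≤        = ℚ.+-mono-≤
  ; *-nonNeg        = *-nonNeg
  ; 1/_             = recip
  ; 1/-inverse      = inverse
  ; 1/-nonNeg       = λ k → ℚ.nonNegative⁻¹ (recip k) {{recip-nonNeg k}}
  }
  where
  open RawMonoidDefs (CommutativeRing.+-rawMonoid ℚ.+-*-commutativeRing) using () renaming (_×_ to _·_)

  *-nonNeg : ∀ {x y} → 0ℚ ℚ.≤ x → 0ℚ ℚ.≤ y → 0ℚ ℚ.≤ x ℚ.* y
  *-nonNeg {x} {y} 0≤x 0≤y = subst (ℚ._≤ x ℚ.* y) (ℚ.*-zeroʳ x)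
    (ℚ.*-monoˡ-≤-nonNeg x {{ℚ.nonNegative 0≤x}} 0≤y)

  fromℕ : ℕ → ℚ
  fromℕ k = + k ℚ./ 1

  fromℕ-pos : ∀ k .{{_ : NonZero k}} → ℚ.Positive (fromℕ k)
  fromℕ-pos k = ℚ.normalize-pos k 1

  recip : (k : ℕ) .{{_ : NonZero k}} → ℚ
  recip k = ℚ.1/_ (fromℕ k) {{ℚ.pos⇒nonZero (fromℕ k) {{fromℕ-pos k}}}}

  recip-nonNeg : ∀ k .{{_ : NonZero k}} → ℚ.NonNegative (recip k)
  recip-nonNeg k = ℚ.pos⇒nonNeg (recip k) {{ℚ.1/pos⇒pos (fromℕ k) {{fromℕ-pos k}}}}

  fromℕ-suc : ∀ k → fromℕ (suc k) ≡ 1ℚ ℚ.+ fromℕ k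
  fromℕ-suc k = ℚ.toℚᵘ-injective (begin
    ℚ.toℚᵘ (fromℕ (suc k))        ≈⟨ ℚ.toℚᵘ-fromℚᵘ (ℚᵘ.mkℚᵘ (+ suc k) 0) ⟩
    ℚᵘ.mkℚᵘ (+ suc k) 0           ≈⟨ ℚᵘ.*≡* (cong (λ z → (+ 1 ℤ.+ z) ℤ.* + 1) (sym (ℤ.*-identityʳ (+ k)))) ⟩
    ℚᵘ.1ℚᵘ ℚᵘ.+ ℚᵘ.mkℚᵘ (+ k) 0   ≈⟨ ℚᵘ.+-congʳ ℚᵘ.1ℚᵘ (ℚᵘ.≃-sym (ℚ.toℚᵘ-fromℚᵘ (ℚᵘ.mkℚᵘ (+ k) 0))) ⟩
    ℚᵘ.1ℚᵘ ℚᵘ.+ ℚ.toℚᵘ (fromℕ k)  ≈⟨ ℚᵘ.≃-sym (ℚ.toℚᵘ-homo-+ 1ℚ (fromℕ k)) ⟩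
    ℚ.toℚᵘ (1ℚ ℚ.+ fromℕ k)       ∎)
    where open ℚᵘ.≃-Reasoning

  ·-fromℕ : ∀ k x → k · x ≡ fromℕ k ℚ.* x
  ·-fromℕ zero    x = sym (ℚ.*-zeroˡ x)
  ·-fromℕ (suc k) x = begin
    x ℚ.+ k · x                  ≡⟨ cong₂ ℚ._+_ (sym (ℚ.*-identityˡ x)) (·-fromℕ k x) ⟩
    1ℚ ℚ.* x ℚ.+ fromℕ k ℚ.* x   ≡⟨ sym (ℚ.*-distribʳ-+ x 1ℚ (fromℕ k)) ⟩
    (1ℚ ℚ.+ fromℕ k) ℚ.* x       ≡⟨ cong (ℚ._* x) (sym (fromℕ-suc k)) ⟩
    fromℕ (suc k) ℚ.* x          ∎
    where open ≡-Reasoning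

  inverse : ∀ k .{{_ : NonZero k}} → k · recip k ≡ 1ℚ
  inverse k = trans (·-fromℕ k (recip k))
    (ℚ.*-inverseʳ (fromℕ k) {{ℚ.pos⇒nonZero (fromℕ k) {{fromℕ-pos k}}}})

{-# OPTIONS --safe #-}

-- Give the last t of the m balls the same pair of bins.  A fixed pair is drawn
-- with probability at least 1/n², so this has probability at least n^(-2t), and
-- whatever the strategy does the two bins together receive t balls.  If they
-- are the two fullest bins at time m − t, their average load then is at least
-- (m − t)/n, so afterwards one of them holds at least m/n + t(1/2 − 1/n) balls.
-- With n^(t-1) ≤ m < n^t the surplus is of order log_n m (because n ≥ 3) and the
-- probability is of order m^(-4).  For 2m ≤ n this fails, because n² need not be
-- bounded by a polynomial in m; but there a single ball already exceeds m/n + (log_n m)/6,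
-- and t = 0 works.
module Submission where

open import Algebra.Properties.CommutativeMonoid.Sum as Sum using ()
open import Algebra.Properties.Semiring.Mult as Mult using ()
open import Data.Fin.Base using (Fin; zero; suc; punchIn)
open import Data.Fin.Properties as Fin using (punchInᵢ≢i)
open import Data.List.Base using (List; []; _∷_; length; map; foldr; allFin; cartesianProduct)
open import Data.List.Membership.Propositional using (_∈_)
open import Data.List.Membership.Propositional.Properties using (∈-allFin; ∈-cartesianProduct⁺; ∈-filter⁺)
open import Data.List.Properties using (filter-accept; filter-reject; length-++; length-filter; length-map; length-tabulate)
open import Data.List.Relation.Unary.Any using (here; there)
open import Data.Nat.Base using (ℕ; zero; suc; _+_; _*_; _^_; _∸_; _≤_; _<_; z≤n; s≤s; >-nonZero)
open import Data.Nat.Properties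
open import Data.Nat.Tactic.RingSolver using (solve-∀)
open import Data.Product.Base using (_×_; _,_; proj₂; ∃-syntax)
open import Data.Sum.Base using (inj₁; inj₂)
open import Function.Base using (_∘_)
open import Relation.Binary.Bundles using (Poset)
import Relation.Binary.Reasoning.PartialOrder as PartialOrderReasoning
open import Relation.Binary.PropositionalEquality using (_≡_; _≢_; refl; sym; trans; cong; cong₂; subst; module ≡-Reasoning)
open import Relation.Nullary.Decidable using (yes; no)
open import Relation.Nullary.Negation using (contradiction)
open import Relation.Unary using (Pred; Decidable)
open import Defs

open Sum +-0-commutativeMonoid using (sum; sum-remove; sum-cong-≗)

-- Sums and largest values over the bins.

sum-≤ : ∀ {n} (f : Fin n → ℕ) b → (∀ i → f i ≤ b) → sum f ≤ n * b
sum-≤ {zero}  f b f≤b = z≤n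
sum-≤ {suc n} f b f≤b = +-mono-≤ (f≤b zero) (sum-≤ (f ∘ suc) b (f≤b ∘ suc))

maximum : ∀ {n} (f : Fin (suc n) → ℕ) → ∃[ i ] ∀ j → f j ≤ f i
maximum {zero}  f = zero , λ { zero → ≤-refl }
maximum {suc n} f with i , max ← maximum (f ∘ suc) | ≤-total (f zero) (f (suc i))
... | inj₁ f0≤fi = suc i , λ { zero → f0≤fi ; (suc j) → max j }
... | inj₂ fi≤f0 = zero , λ { zero → ≤-refl ; (suc j) → ≤-trans (max j) fi≤f0 }

-- Bounding every bin but the fullest by the second fullest leaves, after doubling, an excess of
-- copies of the smaller value; raising half of that excess to the larger value balances the two.
two-largest : ∀ {n} → 2 ≤ n → (f : Fin n → ℕ) →
  ∃[ i ] ∃[ j ] i ≢ j × 2 * sum f ≤ n * (f i + f j)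
two-largest {suc (suc n)} (s≤s (s≤s _)) f
  with i , f≤fi ← maximum f
  with k , f≤fk ← maximum (f ∘ punchIn i)
  = i , punchIn i k , punchInᵢ≢i i k ∘ sym , (begin
    2 * sum f                            ≡⟨ cong (2 *_) (sum-remove {i = i} f) ⟩
    2 * (f i + sum (f ∘ punchIn i))      ≤⟨ *-monoʳ-≤ 2 (+-monoʳ-≤ (f i) (sum-≤ _ y f≤fk)) ⟩
    2 * (f i + suc n * y)                ≡⟨ split n (f i) y ⟩
    (2 * f i + (2 + n) * y) + n * y      ≤⟨ +-monoʳ-≤ _ (*-monoʳ-≤ n (f≤fi (punchIn i k))) ⟩
    (2 * f i + (2 + n) * y) + n * f i    ≡⟨ join n (f i) y ⟩
    (2 + n) * (f i + y)                  ∎)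
  where
  open ≤-Reasoning
  y = f (punchIn i k)
  split : ∀ n x y → 2 * (x + suc n * y) ≡ (2 * x + (2 + n) * y) + n * y
  split = solve-∀
  join : ∀ n x y → (2 * x + (2 + n) * y) + n * x ≡ (2 + n) * (x + y)
  join = solve-∀

-- Loads and the number of distinct pairs.

module _ {n : ℕ} (h : History n) (p : Pair n) {i : Fin n} where

  load-hit : load ((p , i) ∷ h) i ≡ suc (load h i)
  load-hit = cong length (filter-accept (λ s → proj₂ s Fin.≟ i) refl)

  load-miss : ∀ {j} → i ≢ j → load ((p , i) ∷ h) j ≡ load h j
  load-miss {j} i≢j = cong length (filter-reject (λ s → proj₂ s Fin.≟ j) i≢j)

sum-load : ∀ {n} (h : History n) → sum (load h) ≡ length h
sum-load {n}     []            = n≤0⇒n≡0 (≤-trans (sum-≤ {n} _ 0 (λ _ → z≤n)) (≤-reflexive (*-zeroʳ n)))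
sum-load {suc n} ((p , i) ∷ h) = begin
  sum (load h′)                                  ≡⟨ sum-remove {i = i} (load h′) ⟩
  load h′ i + sum (load h′ ∘ punchIn i)          ≡⟨ cong₂ _+_ (load-hit h p)
                                                      (sum-cong-≗ (λ k → load-miss h p (punchInᵢ≢i i k ∘ sym))) ⟩
  suc (load h i + sum (load h ∘ punchIn i))      ≡⟨ cong suc (sum-remove {i = i} (load h)) ⟨
  suc (sum (load h))                             ≡⟨ cong suc (sum-load h) ⟩
  suc (length h)                                 ∎
  where
  open ≡-Reasoning
  h′ = (p , i) ∷ h

length-cartesianProduct : ∀ {a b} {A : Set a} {B : Set b} (xs : List A) (ys : List B) →
  length (cartesianProduct xs ys) ≡ length xs * length ys
length-cartesianProduct []       ys = refl
length-cartesianProduct (x ∷ xs) ys = trans (length-++ (map (x ,_) ys))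
  (cong₂ _+_ (length-map (x ,_) ys) (length-cartesianProduct xs ys))

-- The square, cruder than n(n - 1), makes the forcing probability a power of 1/n, comparable with
-- the powers `n ^ t` near `m`.
length-distinctPairs : ∀ n → length (distinctPairs n) ≤ n * n
length-distinctPairs n = begin
  length (distinctPairs n)                         ≤⟨ length-filter _ (cartesianProduct (allFin n) (allFin n)) ⟩
  length (cartesianProduct (allFin n) (allFin n))  ≡⟨ length-cartesianProduct (allFin n) (allFin n) ⟩
  length (allFin n) * length (allFin n)            ≡⟨ cong (λ k → k * k) (length-tabulate {n = n} (λ i → i)) ⟩
  n * n                                            ∎
  where open ≤-Reasoning

∈-distinctPairs : ∀ {n} {i j : Fin n} → i ≢ j → (i , j) ∈ distinctPairs n
∈-distinctPairs {i = i} {j} i≢j =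
  ∈-filter⁺ _ (∈-cartesianProduct⁺ (∈-allFin i) (∈-allFin j)) i≢j

-- Inequalities in the ordered ring.

module LowerBounds {c ℓ₁ ℓ₂} (R : Scalars c ℓ₁ ℓ₂) where
  open Scalars R
    using (Carrier; _≈_; 0#; 1#; -_; _·_; 1/_; 1/-inverse; 1/-nonNeg; *-nonNeg; isPartialOrder;
           semiring; distribˡ; distribʳ; -‿inverseʳ)
    renaming (_≤_ to _≼_; _+_ to _⊕_; _*_ to _⊗_; _-_ to _⊖_;
              refl to ≈-refl; sym to ≈-sym; trans to ≈-trans; +-mono-≤ to ⊕-mono-≤;
              +-identityˡ to ⊕-identityˡ; +-identityʳ to ⊕-identityʳ; +-comm to ⊕-comm; +-assoc to ⊕-assoc;
              +-cong to ⊕-cong; +-congˡ to ⊕-congˡ; +-congʳ to ⊕-congʳ;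
              *-congˡ to ⊗-congˡ; *-congʳ to ⊗-congʳ; *-identityˡ to ⊗-identityˡ)
  open TwoChoice R
  open Mult semiring using (×-congʳ; ×-homo-1; ×-assocˡ; ×-comm-*; ×-assoc-*)

  poset : Poset c ℓ₁ ℓ₂
  poset = record { isPartialOrder = isPartialOrder }

  open PartialOrderReasoning poset
  open Poset poset using () renaming (refl to ≼-refl; trans to ≼-trans; reflexive to ≼-reflexive)

  x⊕[y⊖x]≈y : ∀ x y → x ⊕ (y ⊖ x) ≈ y
  x⊕[y⊖x]≈y x y = begin-equality
    x ⊕ (y ⊖ x)    ≈⟨ ⊕-congˡ (⊕-comm y (- x)) ⟩
    x ⊕ (- x ⊕ y)  ≈⟨ ⊕-assoc x (- x) y ⟨
    (x ⊖ x) ⊕ y    ≈⟨ ⊕-congʳ (-‿inverseʳ x) ⟩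
    0# ⊕ y         ≈⟨ ⊕-identityˡ y ⟩
    y              ∎

  x≼y⇒0≼y⊖x : ∀ {x y} → x ≼ y → 0# ≼ y ⊖ x
  x≼y⇒0≼y⊖x {x} {y} x≼y = begin
    0#     ≈⟨ -‿inverseʳ x ⟨
    x ⊖ x  ≤⟨ ⊕-mono-≤ x≼y ≼-refl ⟩
    y ⊖ x  ∎

  -- The axioms constrain products only through nonnegativity, so `z ⊗ (y ⊖ x)` is added to the
  -- smaller side.
  ⊗-monoˡ-≼ : ∀ {z x y} → 0# ≼ z → x ≼ y → z ⊗ x ≼ z ⊗ y
  ⊗-monoˡ-≼ {z} {x} {y} 0≼z x≼y = begin
    z ⊗ x                      ≈⟨ ⊕-identityʳ _ ⟨
    z ⊗ x ⊕ 0#                 ≤⟨ ⊕-mono-≤ ≼-refl (*-nonNeg 0≼z (x≼y⇒0≼y⊖x x≼y)) ⟩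
    z ⊗ x ⊕ z ⊗ (y ⊖ x)        ≈⟨ distribˡ z x (y ⊖ x) ⟨
    z ⊗ (x ⊕ (y ⊖ x))          ≈⟨ ⊗-congˡ (x⊕[y⊖x]≈y x y) ⟩
    z ⊗ y                      ∎

  -- Not an axiom: it comes from the nonnegative inverse of 1, which is `1#` itself.
  0≼1 : 0# ≼ 1#
  0≼1 = ≼-trans (1/-nonNeg 1) (≼-reflexive (≈-trans (≈-sym (×-homo-1 _)) (1/-inverse 1)))

  ·-monoʳ-≼ : ∀ k {x y} → x ≼ y → k · x ≼ k · y
  ·-monoʳ-≼ zero    x≼y = ≼-refl
  ·-monoʳ-≼ (suc k) x≼y = ⊕-mono-≤ x≼y (·-monoʳ-≼ k x≼y)

  0≼· : ∀ k {x} → 0# ≼ x → 0# ≼ k · x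
  0≼· zero    0≼x = ≼-refl
  0≼· (suc k) 0≼x = ≼-trans (≼-reflexive (≈-sym (⊕-identityʳ 0#))) (⊕-mono-≤ 0≼x (0≼· k 0≼x))

  ·-monoˡ-≼ : ∀ {k l x} → 0# ≼ x → k ≤ l → k · x ≼ l · x
  ·-monoˡ-≼ {l = l} 0≼x z≤n       = 0≼· l 0≼x
  ·-monoˡ-≼         0≼x (s≤s k≤l) = ⊕-mono-≤ ≼-refl (·-monoˡ-≼ 0≼x k≤l)

  ·-distribˡ-⊕ : ∀ k x y → k · (x ⊕ y) ≈ k · x ⊕ k · y
  ·-distribˡ-⊕ k x y = begin-equality
    k · (x ⊕ y)                            ≈⟨ scale (x ⊕ y) ⟩
    (k · 1#) ⊗ (x ⊕ y)                     ≈⟨ distribˡ _ x y ⟩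
    (k · 1#) ⊗ x ⊕ (k · 1#) ⊗ y            ≈⟨ ⊕-cong (scale x) (scale y) ⟨
    k · x ⊕ k · y                          ∎
    where
    scale : ∀ z → k · z ≈ (k · 1#) ⊗ z
    scale z = ≈-sym (≈-trans (×-assoc-* k 1# z) (×-congʳ k (⊗-identityˡ z)))

  -- Lower bounds b/k on probabilities are carried as `b ≼ k · x`. A bound valid for both placements
  -- survives the strategy's randomization because the weights add up to `1#`.
  convex-≽ : ∀ k {b p x y} → 0# ≼ p → p ≼ 1# → b ≼ k · x → b ≼ k · y →
    b ≼ k · (p ⊗ x ⊕ (1# ⊖ p) ⊗ y)
  convex-≽ k {b} {p} {x} {y} 0≼p p≼1 b≼x b≼y = begin
    b                                    ≈⟨ ⊗-identityˡ b ⟨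
    1# ⊗ b                               ≈⟨ ⊗-congʳ (x⊕[y⊖x]≈y p 1#) ⟨
    (p ⊕ (1# ⊖ p)) ⊗ b                   ≈⟨ distribʳ b p (1# ⊖ p) ⟩
    p ⊗ b ⊕ (1# ⊖ p) ⊗ b                 ≤⟨ ⊕-mono-≤ (⊗-monoˡ-≼ 0≼p b≼x) (⊗-monoˡ-≼ (x≼y⇒0≼y⊖x p≼1) b≼y) ⟩
    p ⊗ (k · x) ⊕ (1# ⊖ p) ⊗ (k · y)     ≈⟨ ⊕-cong (×-comm-* k p x) (×-comm-* k (1# ⊖ p) y) ⟩
    k · (p ⊗ x) ⊕ k · ((1# ⊖ p) ⊗ y)     ≈⟨ ·-distribˡ-⊕ k _ _ ⟨
    k · (p ⊗ x ⊕ (1# ⊖ p) ⊗ y)           ∎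

  -- Averages over a list.

  module _ {a} {A : Set a} where

    total : List A → (A → Carrier) → Carrier
    total xs f = foldr _⊕_ 0# (map f xs)

    total-≽ : ∀ k {b} (f : A → Carrier) → (∀ x → b ≼ k · f x) → ∀ xs → length xs · b ≼ k · total xs f
    total-≽ k f b≼ []       = 0≼· k ≼-refl
    total-≽ k f b≼ (x ∷ xs) =
      ≼-trans (⊕-mono-≤ (b≼ x) (total-≽ k f b≼ xs)) (≼-reflexive (≈-sym (·-distribˡ-⊕ k _ _)))

    member≼total : ∀ (f : A → Carrier) → (∀ x → 0# ≼ f x) → ∀ {x xs} → x ∈ xs → f x ≼ total xs f
    member≼total f 0≼f {x} {_ ∷ xs} (here refl) = begin
      f x             ≈⟨ ⊕-identityʳ (f x) ⟨
      f x ⊕ 0#        ≤⟨ ⊕-mono-≤ ≼-refl (0≼total xs) ⟩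
      f x ⊕ total xs f ∎
      where
      0≼total : ∀ xs → 0# ≼ total xs f
      0≼total []       = ≼-refl
      0≼total (y ∷ ys) = ≼-trans (≼-reflexive (≈-sym (⊕-identityʳ 0#))) (⊕-mono-≤ (0≼f y) (0≼total ys))
    member≼total f 0≼f {x} {y ∷ xs} (there x∈xs) = begin
      f x              ≈⟨ ⊕-identityˡ (f x) ⟨
      0# ⊕ f x         ≤⟨ ⊕-mono-≤ (0≼f y) (member≼total f 0≼f x∈xs) ⟩
      f y ⊕ total xs f ∎

    length·average : ∀ xs (f : A → Carrier) → length xs · average xs f ≈ total xs f
    length·average []          f = ≈-refl
    length·average xs@(_ ∷ ys) f = begin-equality
      length xs · (1/ length xs ⊗ total xs f)    ≈⟨ ×-assoc-* (length xs) _ _ ⟨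
      (length xs · (1/ length xs)) ⊗ total xs f  ≈⟨ ⊗-congʳ (1/-inverse (length xs)) ⟩
      1# ⊗ total xs f                            ≈⟨ ⊗-identityˡ _ ⟩
      total xs f                                 ∎

    -- The member `z` excludes the empty list, whose average is `0#` by convention.
    average-≽ : ∀ k {b} (f : A → Carrier) → (∀ x → b ≼ k · f x) → ∀ {z xs} → z ∈ xs → b ≼ k · average xs f
    average-≽ k {b} f b≼ {xs = xs@(_ ∷ _)} _ = begin
      b                                ≈⟨ ⊗-identityˡ b ⟨
      1# ⊗ b                           ≈⟨ ⊗-congʳ (1/-inverse (length xs)) ⟨
      (length xs · u) ⊗ b              ≈⟨ ×-assoc-* (length xs) u b ⟩
      length xs · (u ⊗ b)              ≈⟨ ×-comm-* (length xs) u b ⟨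
      u ⊗ (length xs · b)              ≤⟨ ⊗-monoˡ-≼ (1/-nonNeg (length xs)) (total-≽ k f b≼ xs) ⟩
      u ⊗ (k · total xs f)             ≈⟨ ×-comm-* k u (total xs f) ⟩
      k · (u ⊗ total xs f)             ∎
      where u = 1/ length xs

  -- Insertions with arbitrary and with prescribed pairs.

  module _ {n : ℕ} {i j : Fin n} (i≢j : i ≢ j) (σ : Strategy n)
           {e} {E : Pred (History n) e} (E? : Decidable E) where
    open Strategy σ

    next : ℕ → History n → Pair n → Carrier
    next r h (i , j) = probFirst h (i , j) ⊗ probFrom σ E? r (((i , j) , i) ∷ h)
      ⊕ (1# ⊖ probFirst h (i , j)) ⊗ probFrom σ E? r (((i , j) , j) ∷ h)

    -- A bound valid for every history of the right length passes back through each placement and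
    -- each draw. The pair from `i≢j` makes the average one over a nonempty list.
    unforced : ∀ k {b} t r h →
      (∀ h′ → length h′ ≡ r + length h → b ≼ k · probFrom σ E? t h′) →
      b ≼ k · probFrom σ E? (r + t) h
    unforced k t zero    h b≼ = b≼ h refl
    unforced k t (suc r) h b≼ = average-≽ k (next (r + t) h)
      (λ p → convex-≽ k (0≤probFirst h p) (probFirst≤1 h p) (later _) (later _))
      (∈-distinctPairs i≢j)
      where
      later : ∀ s → _ ≼ k · probFrom σ E? (r + t) (s ∷ h)
      later s = unforced k t r (s ∷ h) (λ h′ eq → b≼ h′ (trans eq (+-suc r (length h))))

    -- The final indicator is nonnegative; `unforced` with multiplier 1 carries this back over all
    -- draws.
    0≼probFrom : ∀ r h → 0# ≼ probFrom σ E? r h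
    0≼probFrom r h = ≼-trans
      (subst (λ s → 0# ≼ 1 · probFrom σ E? s h) (+-identityʳ r)
        (unforced 1 0 r h (λ h′ _ → 0≼· 1 (0≼indicator h′))))
      (≼-reflexive (×-homo-1 _))
      where
      0≼indicator : ∀ h → 0# ≼ probFrom σ E? 0 h
      0≼indicator h with E? h
      ... | yes _ = 0≼1
      ... | no  _ = ≼-refl

    -- It suffices to keep the outcomes in which every draw is `(i , j)`. Each such draw has weight
    -- 1/N, for N distinct pairs, and whichever of the two bins is chosen, their combined load grows
    -- by one.
    forced : ∀ r h →
      (∀ h′ → r + (load h i + load h j) ≤ load h′ i + load h′ j → E h′) →
      1# ≼ (length (distinctPairs n) ^ r) · probFrom σ E? r h
    forced zero h holds with E? h
    ... | yes _  = ≼-reflexive (≈-sym (×-homo-1 1#))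
    ... | no ¬Eh = contradiction (holds h ≤-refl) ¬Eh
    forced (suc r) h holds = begin
      1#                            ≤⟨ convex-≽ (N ^ r) (0≤probFirst h p) (probFirst≤1 h p)
                                         (later i (cong₂ _+_ (load-hit h p) (load-miss h p i≢j)))
                                         (later j (trans (cong₂ _+_ (load-miss h p (i≢j ∘ sym)) (load-hit h p)) (+-suc _ _))) ⟩
      -- The other pairs contribute nonnegative terms to the sum, which are dropped.
      (N ^ r) · next r h p            ≤⟨ ·-monoʳ-≼ (N ^ r) (member≼total (next r h) 0≼next (∈-distinctPairs i≢j)) ⟩
      (N ^ r) · total ps (next r h)   ≈⟨ ×-congʳ (N ^ r) (length·average ps (next r h)) ⟨
      (N ^ r) · (N · average ps (next r h)) ≈⟨ ×-assocˡ _ (N ^ r) N ⟩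
      (N ^ r * N) · average ps (next r h) ≡⟨ cong (_· average ps (next r h)) (*-comm (N ^ r) N) ⟩
      (N * N ^ r) · average ps (next r h) ∎
      where
      p = i , j
      ps = distinctPairs n
      N = length ps

      0≼next : ∀ q → 0# ≼ next r h q
      0≼next q = ≼-trans
        (convex-≽ 1 (0≤probFirst h q) (probFirst≤1 h q) (0≼· 1 (0≼probFrom r _)) (0≼· 1 (0≼probFrom r _)))
        (≼-reflexive (×-homo-1 _))

      later : ∀ k → load ((p , k) ∷ h) i + load ((p , k) ∷ h) j ≡ suc (load h i + load h j) →
        1# ≼ (N ^ r) · probFrom σ E? r ((p , k) ∷ h)
      -- The combined load gains one while `r` drops by one, so the threshold in `holds` stays the
      -- same.
      later k eq = forced r ((p , k) ∷ h) λ h′ le → holds h′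
        (subst (_≤ load h′ i + load h′ j) (trans (cong (r +_) eq) (+-suc r _)) le)

  -- The forced pair may depend on the history after `s` balls, since `forced` bounds the
  -- conditional probability given each such history.
  force-last : ∀ {n} → 2 ≤ n → (σ : Strategy n) →
    ∀ {e} {E : Pred (History n) e} (E? : Decidable E) t s {k} →
    length (distinctPairs n) ^ t ≤ k →
    (∀ h → length h ≡ s → ∃[ i ] ∃[ j ] i ≢ j ×
      (∀ h′ → t + (load h i + load h j) ≤ load h′ i + load h′ j → E h′)) →
    1# ≼ k · Pr σ E? (s + t)
  force-last {suc (suc n)} (s≤s (s≤s _)) σ E? t s N^t≤k pairs = ≼-trans
    -- `0≢1` shows that some pair can be drawn; the forced pair comes from `pairs`.
    (unforced 0≢1 σ E? (length (distinctPairs (2 + n)) ^ t) t s [] λ h eq →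
      let i , j , i≢j , holds = pairs h (trans eq (+-identityʳ s)) in forced i≢j σ E? t h holds)
    (·-monoˡ-≼ (0≼probFrom 0≢1 σ E? (s + t) []) N^t≤k)
    where
    0≢1 : zero {n = suc n} ≢ suc zero
    0≢1 ()

-- The number of forced balls.

floorLog : ∀ b → 2 ≤ b → ∀ m → 1 ≤ m → ∃[ k ] b ^ k ≤ m × m < b ^ suc k
floorLog b 2≤b (suc zero)      _ = 0 , ≤-refl , ≤-trans 2≤b (≤-reflexive (sym (*-identityʳ b)))
floorLog b 2≤b (suc (suc m)) _ with k , lo , hi ← floorLog b 2≤b (suc m) (s≤s z≤n) | m≤n⇒m<n∨m≡n hi
... | inj₁ hi′ = k , m≤n⇒m≤1+n lo , hi′
... | inj₂ eq  = suc k , ≤-reflexive (sym eq) ,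
  subst (_< b ^ suc (suc k)) (sym eq) (^-monoʳ-< b 2≤b (n<1+n (suc k)))

k<b^k : ∀ b → 2 ≤ b → ∀ k → k < b ^ k
k<b^k b 2≤b zero    = ≤-refl
k<b^k b 2≤b (suc k) = ≤-<-trans (k<b^k b 2≤b k) (^-monoʳ-< b 2≤b (n<1+n k))

-- After `s` free balls, `t` are forced. The premise on `ℓ` is a load of at least s/n + t/2, as the
-- fuller forced bin has; the goal then reduces to comparing exponents of `n`.
forcedCount : ∀ n → 3 ≤ n → ∀ m → 1 ≤ m →
  ∃[ t ] ∃[ s ] s + t ≡ m × (n * n) ^ t ≤ 4 * m ^ 4 ×
    (∀ ℓ → 2 * s + n * t ≤ 2 * (n * ℓ) → AtLeastMeanPlusLog 6 n n m ℓ)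
forcedCount n@(suc n′) 3≤n m 1≤m with 2 * m ≤? n
... | yes 2m≤n = 0 , m , +-identityʳ m , *-mono-≤ {1} {4} (s≤s z≤n) (m^n>0 m {{>-nonZero 1≤m}} 4) , overloaded
  where
  open ≤-Reasoning
  overloaded : ∀ ℓ → 2 * m + n * 0 ≤ 2 * (n * ℓ) → AtLeastMeanPlusLog 6 n n m ℓ
  overloaded zero le = contradiction 1≤m (<⇒≱ (s≤s (*-cancelˡ-≤ 2 (begin
    2 * m          ≤⟨ m≤m+n _ _ ⟩
    2 * m + n * 0  ≤⟨ le ⟩
    2 * (n * 0)    ≡⟨ cong (2 *_) (*-zeroʳ n) ⟩
    2 * 0          ∎))))
  -- As `m ≤ n`, log_n m is at most 1, and one ball suffices: n + 6m ≤ 4n ≤ 6n.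
  overloaded (suc ℓ) _ = begin
    m ^ n * n ^ (6 * m)       ≤⟨ *-monoˡ-≤ _ (^-monoˡ-≤ n (≤-trans (m≤m+n m _) 2m≤n)) ⟩
    n ^ n * n ^ (6 * m)       ≡⟨ ^-distribˡ-+-* n n (6 * m) ⟨
    n ^ (n + 6 * m)           ≤⟨ ^-monoʳ-≤ n exponent ⟩
    n ^ (6 * n * suc ℓ)       ∎
    where
    6m : ∀ m → 6 * m ≡ 3 * (2 * m)
    6m = solve-∀
    split : ∀ n ℓ → 6 * n * suc ℓ ≡ (n + 3 * n) + (2 * n + 6 * n * ℓ)
    split = solve-∀
    exponent : n + 6 * m ≤ 6 * n * suc ℓ
    exponent = begin
      n + 6 * m                        ≡⟨ cong (n +_) (6m m) ⟩
      n + 3 * (2 * m)                  ≤⟨ +-monoʳ-≤ n (*-monoʳ-≤ 3 2m≤n) ⟩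
      n + 3 * n                        ≤⟨ m≤m+n _ _ ⟩
      (n + 3 * n) + (2 * n + 6 * n * ℓ) ≡⟨ split n ℓ ⟨
      6 * n * suc ℓ                    ∎
... | no 2m≰n with k , lo , hi ← floorLog n (≤-trans (n≤1+n 2) 3≤n) m 1≤m =
  t , m ∸ t , m∸n+n≡m t≤m , poly , overloaded
  where
  open ≤-Reasoning
  -- Rounded up, so that `t` bounds log_n m from above.
  t = suc k

  t≤m : t ≤ m
  t≤m = ≤-trans (k<b^k n (≤-trans (n≤1+n 2) 3≤n) k) lo

  -- Rounding the exponent up costs a factor `n`. For `k` = 0 it is below 2m, as 2m ≤ n fails;
  -- otherwise n ≤ n^k ≤ m.
  n^t≤2m² : ∀ k → n ^ k ≤ m → n ^ suc k ≤ 2 * (m * m)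
  n^t≤2m² zero    lo = begin
    n * 1        ≡⟨ *-identityʳ n ⟩
    n            ≤⟨ <⇒≤ (≰⇒> 2m≰n) ⟩
    2 * m        ≤⟨ *-monoʳ-≤ 2 (m≤m*n m m {{>-nonZero 1≤m}}) ⟩
    2 * (m * m)  ∎
  n^t≤2m² (suc k) lo = begin
    n * n ^ suc k  ≤⟨ *-mono-≤ (≤-trans (m≤m*n n (n ^ k) {{m^n≢0 n k}}) lo) lo ⟩
    m * m          ≤⟨ m≤m+n _ _ ⟩
    2 * (m * m)    ∎

  poly : (n * n) ^ t ≤ 4 * m ^ 4
  poly = begin
    (n * n) ^ t                ≡⟨ ^-distribʳ-* t n n ⟩
    n ^ t * n ^ t              ≤⟨ *-mono-≤ (n^t≤2m² k lo) (n^t≤2m² k lo) ⟩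
    2 * (m * m) * (2 * (m * m)) ≡⟨ square m ⟩
    4 * m ^ 4                  ∎
    where
    square : ∀ m → 2 * (m * m) * (2 * (m * m)) ≡ 4 * (m * (m * (m * (m * 1))))
    square = solve-∀
    ^-distribʳ-* : ∀ k a b → (a * b) ^ k ≡ a ^ k * b ^ k
    ^-distribʳ-* zero    a b = refl
    ^-distribʳ-* (suc k) a b = trans (cong (a * b *_) (^-distribʳ-* k a b)) (interchange a b (a ^ k) (b ^ k))
      where
      interchange : ∀ a b c d → a * b * (c * d) ≡ a * c * (b * d)
      interchange = solve-∀

  overloaded : ∀ ℓ → 2 * (m ∸ t) + n * t ≤ 2 * (n * ℓ) → AtLeastMeanPlusLog 6 n n m ℓ
  overloaded ℓ le = begin
    m ^ n * n ^ (6 * m)         ≤⟨ *-monoˡ-≤ _ (^-monoˡ-≤ n (<⇒≤ hi)) ⟩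
    (n ^ t) ^ n * n ^ (6 * m)   ≡⟨ cong (_* n ^ (6 * m)) (^-*-assoc n t n) ⟩
    n ^ (t * n) * n ^ (6 * m)   ≡⟨ ^-distribˡ-+-* n (t * n) (6 * m) ⟨
    n ^ (t * n + 6 * m)         ≤⟨ ^-monoʳ-≤ n exponent ⟩
    n ^ (6 * n * ℓ)             ∎
    where
    regroup : ∀ n t s → t * n + 6 * (s + t) ≡ (6 * s + n * t) + 2 * (3 * t)
    regroup = solve-∀
    collect : ∀ n t s → (6 * s + n * t) + 2 * (n * t) ≡ 3 * (2 * s + n * t)
    collect = solve-∀
    scale : ∀ n ℓ → 3 * (2 * (n * ℓ)) ≡ 6 * n * ℓ
    scale = solve-∀
    exponent : t * n + 6 * m ≤ 6 * n * ℓ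
    -- Here 3 ≤ n and the constant 6 enter: the surplus t(1/2 - 1/n) is at least t/6, with equality
    -- for n = 3. Cleared of denominators, this is 6t ≤ 2nt.
    exponent = begin
      t * n + 6 * m                          ≡⟨ cong (λ x → t * n + 6 * x) (m∸n+n≡m t≤m) ⟨
      t * n + 6 * (m ∸ t + t)                ≡⟨ regroup n t (m ∸ t) ⟩
      (6 * (m ∸ t) + n * t) + 2 * (3 * t)    ≤⟨ +-monoʳ-≤ _ (*-monoʳ-≤ 2 (*-monoˡ-≤ t 3≤n)) ⟩
      (6 * (m ∸ t) + n * t) + 2 * (n * t)    ≡⟨ collect n t (m ∸ t) ⟩
      3 * (2 * (m ∸ t) + n * t)              ≤⟨ *-monoʳ-≤ 3 le ⟩
      3 * (2 * (n * ℓ))                      ≡⟨ scale n ℓ ⟩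
      6 * n * ℓ                              ∎

-- From the forced pair to an overloaded bin.

average≤maximum : ∀ {n} (f : Fin n → ℕ) i j → ∃[ k ] f i + f j ≤ 2 * f k
average≤maximum f i j with ≤-total (f i) (f j)
... | inj₁ fi≤fj = j , +-mono-≤ fi≤fj (m≤m+n (f j) 0)
... | inj₂ fj≤fi = i , +-monoʳ-≤ (f i) (≤-trans fj≤fi (m≤m+n (f i) 0))

-- The two fullest bins hold at least 2s/n balls together by `two-largest`. After gaining `t` more,
-- the fuller of them has at least half of the total.
forced⇒overloaded : ∀ {K b n m t s} → 2 ≤ n →
  (∀ ℓ → 2 * s + n * t ≤ 2 * (n * ℓ) → AtLeastMeanPlusLog K b n m ℓ) →
  ∀ h → length h ≡ s → ∃[ i ] ∃[ j ] i ≢ j ×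
    (∀ h′ → t + (load h i + load h j) ≤ load h′ i + load h′ j → SomeBinOverloaded K b n m h′)
forced⇒overloaded {K} {b} {n} {m} {t} {s} 2≤n overloaded h eq with i , j , i≢j , le ← two-largest 2≤n (load h) =
  i , j , i≢j , heavy
  where
  open ≤-Reasoning
  swap : ∀ n x → n * (2 * x) ≡ 2 * (n * x)
  swap = solve-∀
  heavy : ∀ h′ → t + (load h i + load h j) ≤ load h′ i + load h′ j → SomeBinOverloaded K b n m h′
  heavy h′ gained with k , half ← average≤maximum (load h′) i j = k , overloaded (load h′ k) (begin
    2 * s + n * t                          ≡⟨ cong (λ x → 2 * x + n * t) (trans (sum-load h) eq) ⟨
    2 * sum (load h) + n * t               ≤⟨ +-monoˡ-≤ (n * t) le ⟩
    n * (load h i + load h j) + n * t      ≡⟨ *-distribˡ-+ n (load h i + load h j) t ⟨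
    n * (load h i + load h j + t)          ≡⟨ cong (n *_) (+-comm _ t) ⟩
    n * (t + (load h i + load h j))        ≤⟨ *-monoʳ-≤ n (≤-trans gained half) ⟩
    n * (2 * load h′ k)                    ≡⟨ swap n (load h′ k) ⟩
    2 * (n * load h′ k)                    ∎)

-- The probability bound and the theorem.

module _ {c ℓ₁ ℓ₂} (R : Scalars c ℓ₁ ℓ₂) where
  open TwoChoice R
  open LowerBounds R

  -- The event `E` is left general so that one argument serves both logarithm bases.
  overload-probable : ∀ n → 3 ≤ n → ∀ m → 1 ≤ m → (σ : Strategy n) →
    ∀ {e} {E : Pred (History n) e} (E? : Decidable E) →
    (∀ h → SomeBinOverloaded 6 n n m h → E h) →
    AtLeastInversePoly 4 4 m (Pr σ E? m)
  overload-probable n 3≤n m 1≤m σ {E = E} E? overloaded⇒E = conclude (forcedCount n 3≤n m 1≤m)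
    where
    2≤n = ≤-trans (n≤1+n 2) 3≤n

    conclude : (∃[ t ] ∃[ s ] s + t ≡ m × (n * n) ^ t ≤ 4 * m ^ 4 ×
                 (∀ ℓ → 2 * s + n * t ≤ 2 * (n * ℓ) → AtLeastMeanPlusLog 6 n n m ℓ)) →
               AtLeastInversePoly 4 4 m (Pr σ E? m)
    conclude (t , s , refl , poly , overloaded) = force-last 2≤n σ E? t s
      (≤-trans (^-monoˡ-≤ t (length-distinctPairs n)) poly)
      λ h eq → let i , j , i≢j , heavy = forced⇒overloaded {6} {n} 2≤n overloaded h eq in
        i , j , i≢j , λ h′ gained → overloaded⇒E h′ (heavy h′ gained)

-- Since 4 is the square of 2, log_4 m is half of log_2 m, so passing to base 2 doubles `K`.
log₄⇒log₂ : ∀ m ℓ → AtLeastMeanPlusLog 6 4 4 m ℓ → AtLeastMeanPlusLog 12 2 4 m ℓ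
log₄⇒log₂ m ℓ le = begin
  m ^ 4 * 2 ^ (12 * m)   ≡⟨ cong (m ^ 4 *_) (4^6x m) ⟨
  m ^ 4 * 4 ^ (6 * m)    ≤⟨ le ⟩
  4 ^ (6 * 4 * ℓ)        ≡⟨ trans (^-*-assoc 2 2 (24 * ℓ)) (cong (2 ^_) (sym (*-assoc 2 24 ℓ))) ⟩
  2 ^ (12 * 4 * ℓ)       ∎
  where
  open ≤-Reasoning
  4^6x : ∀ x → 4 ^ (6 * x) ≡ 2 ^ (12 * x)
  4^6x x = trans (^-*-assoc 2 2 (6 * x)) (cong (2 ^_) (sym (*-assoc 2 6 x)))

proposition6 : ∀ {c ℓ₁ ℓ₂} (R : Scalars c ℓ₁ ℓ₂) → let open TwoChoice R in
    (∃[ K ] ∃[ C ] ∃[ d ] 1 ≤ K ×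
    (∀ (m : ℕ) → 1 ≤ m → (σ : Strategy 4) →
    AtLeastInversePoly C d m (Pr σ (someBinOverloaded? K 2 4 m) m)))
    × (∃[ K ] ∃[ C ] ∃[ d ] 1 ≤ K ×
    (∀ (n : ℕ) → 3 ≤ n → (m : ℕ) → 1 ≤ m → (σ : Strategy n) →
    AtLeastInversePoly C d m (Pr σ (someBinOverloaded? K n n m) m)))
proposition6 R =
    -- Four bins are the case n = 4 read in base 2, whence 12 = 2 · 6. Both probabilities are at
    -- least 1/(4m^4).
    (12 , 4 , 4 , s≤s z≤n , λ m 1≤m σ →
      overload-probable R 4 (n≤1+n 3) m 1≤m σ (someBinOverloaded? 12 2 4 m)
        λ h (i , le) → i , log₄⇒log₂ m (load h i) le)
  , (6 , 4 , 4 , s≤s z≤n , λ n 3≤n m 1≤m σ →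
      overload-probable R n 3≤n m 1≤m σ (someBinOverloaded? 6 n n m) λ h over → over)
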